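{- Let $r\ge 2$ be an integer that is the order of some finite projective plane. Let $s\ge r^3+1$ and $t\in\{0,1,\dots,r\}$ be integers. Then \[ (r^2+r+1)s+t\;\le\;\operatorname{achr}\bigl(K_{r^2+r+1}\,\square\, K_{(r+1)s+t}\bigr)\;\le\;(r^2+r+1)s+rt. \]
   Context: A vertex colouring $f:V(G)\to C$ of a finite simple graph $G$ with a finite colour set $C$ is complete if for any two distinct colours $c_1,c_2\in C$ there are adjacent vertices $v_1,v_2$ with $f(v_1)=c_1$, $f(v_2)=c_2$. The achromatic number $\operatorname{achr}(G)$ is the maximum number of colours in a proper complete vertex colouring of $G$. The Cartesian product $G_1\square G_2$ has vertex set $V(G_1)\times V(G_2)$, with $(x_1,y_1)$ adjacent to $(x_2,y_2)$ iff either $x_1=x_2$ and $y_1y_2\in E(G_2)$, or $x_1x_2\in E(G_1)$ and $y_1=y_2$. For $r\ge2$, a finite projective plane of order $r$ is a pair $(P,\mathcal L)$ of a finite set $P$ of points and a set $\mathcal L$ of subsets of $P$ (lines) such that any two distinct points lie in exactly one common line, any two distinct lines intersect, there are four points no three of which lie on a common line (equivalently, the four points determine six distinct lines), and some line has exactly $r+1$ points; $r$ is a finite projective plane order if such a plane exists. -}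

module Defs where

open import Data.Nat using (ℕ; _+_; _*_; _^_; _≤_)
open import Data.Fin using (Fin)
open import Data.Fin.Subset using (Subset; _∈_; ∣_∣)
open import Data.Product using (Σ; ∃; ∃-syntax; _×_; _,_)
open import Relation.Binary.PropositionalEquality using (_≡_; _≢_)
open import Relation.Nullary using (¬_)
open import Function.Definitions using (Injective)

record SimpleGraph : Set₁ where
  field
    V     : Set
    Adj   : V → V → Set
    irrefl : ∀ v → ¬ Adj v v
    sym   : ∀ u v → Adj u v → Adj v u
open SimpleGraph public

K : ℕ → SimpleGraph
K n = record
  { V = Fin n
  ; Adj = λ x y → x ≢ y
  ; irrefl = λ v h → h Relation.Binary.PropositionalEquality.refl
  ; sym = λ u v h e → h (Relation.Binary.PropositionalEquality.sym e)
  }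

data CartAdj (G₁ G₂ : SimpleGraph) : V G₁ × V G₂ → V G₁ × V G₂ → Set where
  inRight : ∀ {x y₁ y₂} → Adj G₂ y₁ y₂ → CartAdj G₁ G₂ (x , y₁) (x , y₂)
  inLeft  : ∀ {x₁ x₂ y} → Adj G₁ x₁ x₂ → CartAdj G₁ G₂ (x₁ , y) (x₂ , y)

_□_ : SimpleGraph → SimpleGraph → SimpleGraph
G₁ □ G₂ = record
  { V = V G₁ × V G₂
  ; Adj = CartAdj G₁ G₂
  ; irrefl = irr
  ; sym = sy
  }
  where
  irr : ∀ v → ¬ CartAdj G₁ G₂ v v
  irr (x , y) (inRight a) = irrefl G₂ y a
  irr (x , y) (inLeft a)  = irrefl G₁ x a
  sy : ∀ u v → CartAdj G₁ G₂ u v → CartAdj G₁ G₂ v u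
  sy _ _ (inRight {y₁ = y₁} {y₂} a) = inRight (sym G₂ y₁ y₂ a)
  sy _ _ (inLeft {x₁ = x₁} {x₂} a)  = inLeft (sym G₁ x₁ x₂ a)

IsProper : (G : SimpleGraph) {k : ℕ} → (V G → Fin k) → Set
IsProper G f = ∀ u v → Adj G u v → f u ≢ f v

IsComplete : (G : SimpleGraph) {k : ℕ} → (V G → Fin k) → Set
IsComplete G {k} f = ∀ (c₁ c₂ : Fin k) → c₁ ≢ c₂ →
  ∃[ v₁ ] ∃[ v₂ ] (Adj G v₁ v₂ × f v₁ ≡ c₁ × f v₂ ≡ c₂)

HasCompleteColouring : SimpleGraph → ℕ → Set
HasCompleteColouring G k = Σ (V G → Fin k) λ f → IsProper G f × IsComplete G f

-- achr(G) is the maximum k with HasCompleteColouring G k; we express bounds on it: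
-- a ≤ achr(G)
AchrAtLeast : SimpleGraph → ℕ → Set
AchrAtLeast G a = ∃[ k ] (a ≤ k × HasCompleteColouring G k)

AchrAtMost : SimpleGraph → ℕ → Set
AchrAtMost G b = ∀ k → HasCompleteColouring G k → k ≤ b

record ProjectivePlane (r : ℕ) : Set where
  field
    npts   : ℕ
    nlines : ℕ
    line   : Fin nlines → Subset npts
    line-injective : Injective _≡_ _≡_ line
    two-points : ∀ (p q : Fin npts) → p ≢ q →
      ∃[ l ] ((p ∈ line l × q ∈ line l) ×
              (∀ l′ → p ∈ line l′ → q ∈ line l′ → l′ ≡ l))
    two-lines : ∀ (l m : Fin nlines) → l ≢ m → ∃[ p ] (p ∈ line l × p ∈ line m)
    four-points : ∃[ a ] ∃[ b ] ∃[ c ] ∃[ d ]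
      ( (∀ l → ¬ (a ∈ line l × b ∈ line l × c ∈ line l))
      × (∀ l → ¬ (a ∈ line l × b ∈ line l × d ∈ line l))
      × (∀ l → ¬ (a ∈ line l × c ∈ line l × d ∈ line l))
      × (∀ l → ¬ (b ∈ line l × c ∈ line l × d ∈ line l)) )
    order-line : ∃[ l ] (∣ line l ∣ ≡ r + 1)

IsProjectivePlaneOrder : ℕ → Set
IsProjectivePlaneOrder r = ProjectivePlane r

{-# OPTIONS --safe #-}

-- Upper bound: let m be the frequency of a rarest colour.  If m > r, counting cells bounds the
-- number of colours.  Otherwise every colour occurs in one of the m rows and m columns
-- that contain the rarest one, and r³ < s makes this union too small for more colours.
--
-- Lower bound: identify the rows with the lines of the plane and take the colours (p , k) with
-- p a point and k < s, together with t extra colours.  Row l shows (p , k) for every p on l, in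
-- column (a , k + l mod s) if p is the a-th point of l; two of these colours share the row of
-- a line joining their points.  Each extra colour j is put in every row, displacing the
-- colour in the cell (j or j + 1 , 2l mod s) of row l to the extra column j.  The displaced
-- colour has second coordinate k = l, so extra columns do not repeat a colour.
module Submission where

open import Defs hiding (sym)
open import Data.Nat using (ℕ; _+_; _*_; _^_; _≤_)
open import Data.Product using (_×_)

import Data.Nat.Properties
open import Algebra.Properties.Semiring.Sum Data.Nat.Properties.+-*-semiring
  using (sum; sum-cong-≗; ∑-comm; ∑-distrib-+; *-distribˡ-sum; *-distribʳ-sum)
open import Data.Bool using (true; false)
open import Data.Fin using (Fin; zero; suc; toℕ; fromℕ<; inject≤; inject₁; cast; _≟_)
open import Data.Fin.Properties as Fin using (all?; any?; ¬∀⟶∃¬)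
open import Data.Fin.Subset using (Subset; _∈_; ∣_∣)
open import Data.Fin.Subset.Properties using (_∈?_)
open import Data.Nat as ℕ using (zero; suc; _∸_; _<_; _≤?_; _<?_; z≤n; s≤s)
open import Data.Nat.Properties hiding (_≟_)
open import Data.Nat.Tactic.RingSolver using (solve-∀)
open import Data.Product using (∃; _,_; proj₁; proj₂)
open import Data.Product.Properties using (≡-dec)
open import Data.Sum as Sum using (_⊎_; inj₁; inj₂)
open import Data.Sum.Function.Propositional using (_⊎-↔_)
open import Data.Sum.Properties using (inj₁-injective)
open import Data.Vec using ([]; _∷_; here; there)
open import Function using (id; _∘_; _↔_; Inverse)
open import Function.Properties.Inverse using (↔-refl; ↔-trans)
open import Relation.Binary.Definitions using (DecidableEquality)
open import Relation.Binary.PropositionalEquality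
  using (_≡_; _≢_; refl; sym; trans; cong; cong₂; subst; subst₂; module ≡-Reasoning)
open import Relation.Nullary using (¬_; Dec; yes; no; does; contradiction)

-- Finite sums

indicator : ∀ {ℓ} {A : Set ℓ} → Dec A → ℕ
indicator a? with does a?
... | true  = 1
... | false = 0

indicator-yes : ∀ {ℓ} {A : Set ℓ} (a? : Dec A) → A → indicator a? ≡ 1
indicator-yes (yes _) _ = refl
indicator-yes (no ¬a) a = contradiction a ¬a

indicator-no : ∀ {ℓ} {A : Set ℓ} (a? : Dec A) → ¬ A → indicator a? ≡ 0
indicator-no (yes a) ¬a = contradiction a ¬a
indicator-no (no _)  _  = refl

indicator-≤1 : ∀ {ℓ} {A : Set ℓ} (a? : Dec A) → indicator a? ≤ 1
indicator-≤1 (yes _) = ≤-refl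
indicator-≤1 (no _)  = z≤n

indicator-idem : ∀ {ℓ} {A : Set ℓ} (a? : Dec A) →
  indicator a? * indicator a? ≡ indicator a?
indicator-idem (yes _) = refl
indicator-idem (no _)  = refl

sum-const : ∀ n c → sum {n} (λ _ → c) ≡ n * c
sum-const zero    c = refl
sum-const (suc n) c = cong (c +_) (sum-const n c)

sum-mono : ∀ {n} {f g : Fin n → ℕ} → (∀ i → f i ≤ g i) → sum f ≤ sum g
sum-mono {zero}  f≤g = z≤n
sum-mono {suc n} f≤g = +-mono-≤ (f≤g zero) (sum-mono (f≤g ∘ suc))

-- Dropping the terms at `i` is expressed by adding the opposite terms, which avoids truncated
-- subtraction.
sum-mono-off : ∀ {n} (f g : Fin n → ℕ) i → (∀ j → j ≢ i → f j ≤ g j) →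
  sum f + g i ≤ sum g + f i
sum-mono-off f g zero f≤g = begin
  f zero + sum (f ∘ suc) + g zero ≤⟨ +-monoˡ-≤ (g zero) (+-monoʳ-≤ (f zero) (sum-mono (λ j → f≤g (suc j) λ ()))) ⟩
  f zero + sum (g ∘ suc) + g zero ≡⟨ swap (f zero) _ (g zero) ⟩
  g zero + sum (g ∘ suc) + f zero ∎
  where
  open ≤-Reasoning
  swap : ∀ a b c → a + b + c ≡ c + b + a
  swap = solve-∀
sum-mono-off f g (suc i) f≤g = begin
  f zero + sum (f ∘ suc) + g (suc i)   ≡⟨ +-assoc (f zero) _ _ ⟩
  f zero + (sum (f ∘ suc) + g (suc i))
    ≤⟨ +-mono-≤ (f≤g zero λ ()) (sum-mono-off (f ∘ suc) (g ∘ suc) i λ j j≢i → f≤g (suc j) λ { refl → j≢i refl }) ⟩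
  g zero + (sum (g ∘ suc) + f (suc i)) ≡⟨ +-assoc (g zero) _ _ ⟨
  g zero + sum (g ∘ suc) + f (suc i)   ∎
  where open ≤-Reasoning

sum-cong-off : ∀ {n} (f g : Fin n → ℕ) i → (∀ j → j ≢ i → f j ≡ g j) →
  sum f + g i ≡ sum g + f i
sum-cong-off f g i f≡g = ≤-antisym
  (sum-mono-off f g i λ j j≢i → ≤-reflexive (f≡g j j≢i))
  (sum-mono-off g f i λ j j≢i → ≤-reflexive (sym (f≡g j j≢i)))

sum-single : ∀ {n} (f : Fin n → ℕ) i → (∀ j → j ≢ i → f j ≡ 0) → sum f ≡ f i
sum-single {n} f i f≡0 = begin
  sum f                   ≡⟨ +-identityʳ _ ⟨
  sum f + 0               ≡⟨ sum-cong-off f (λ _ → 0) i f≡0 ⟩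
  sum {n} (λ _ → 0) + f i ≡⟨ cong (_+ f i) (trans (sum-const n 0) (*-zeroʳ n)) ⟩
  f i                     ∎
  where open ≡-Reasoning

term≤sum : ∀ {n} (f : Fin n → ℕ) i → f i ≤ sum f
term≤sum f zero    = m≤m+n (f zero) _
term≤sum f (suc i) = ≤-trans (term≤sum (f ∘ suc) i) (m≤n+m _ (f zero))

sum-≤1 : ∀ {n} (f : Fin n → ℕ) → (∀ i → f i ≤ 1) →
  (∀ i j → f i ≢ 0 → f j ≢ 0 → i ≡ j) → sum f ≤ 1
sum-≤1 {zero}  f f≤1 unique = z≤n
sum-≤1 {suc n} f f≤1 unique with f zero ℕ.≟ 0
... | yes f₀≡0 rewrite f₀≡0 =
  sum-≤1 (f ∘ suc) (f≤1 ∘ suc) λ i j fi fj → Fin.suc-injective (unique (suc i) (suc j) fi fj)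
... | no f₀≢0 = subst (_≤ 1) (sym (sum-single f zero vanish)) (f≤1 zero)
  where
  vanish : ∀ j → j ≢ zero → f j ≡ 0
  vanish j j≢0 with f j ℕ.≟ 0
  ... | yes fj≡0 = fj≡0
  ... | no  fj≢0 = contradiction (unique j zero fj≢0 f₀≢0) j≢0

sum-swap-factor : ∀ {m n} (f : Fin m → ℕ) (g : Fin m → Fin n → ℕ) →
  sum (λ j → sum (λ i → f i * g i j)) ≡ sum (λ i → f i * sum (g i))
sum-swap-factor f g = trans (∑-comm (λ j i → f i * g i j))
  (sum-cong-≗ λ i → sym (*-distribˡ-sum (f i) (g i)))

-- The upper bound

module Frequencies {n q k : ℕ} (f : Fin n × Fin q → Fin k) where

  at : Fin k → Fin n → Fin q → ℕ
  at x i j = indicator (f (i , j) ≟ x)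

  inRow : Fin k → Fin n → ℕ
  inRow x i = sum (at x i)

  inColumn : Fin k → Fin q → ℕ
  inColumn x j = sum (λ i → at x i j)

  frequency : Fin k → ℕ
  frequency x = sum (inRow x)

  sum-at : ∀ i j → sum (λ x → at x i j) ≡ 1
  sum-at i j = trans
    (sum-single _ (f (i , j)) λ x x≢f → indicator-no (f (i , j) ≟ x) (x≢f ∘ sym))
    (indicator-yes (f (i , j) ≟ f (i , j)) refl)

  weighted : (Fin n → Fin q → ℕ) → Fin k → ℕ
  weighted w x = sum (λ i → sum (λ j → w i j * at x i j))

  -- Every cell has exactly one colour, so its weight is counted once.
  sum-weighted : ∀ w → sum (weighted w) ≡ sum (λ i → sum (w i))
  sum-weighted w = begin
    sum (λ x → sum (λ i → sum (λ j → w i j * at x i j)))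
      ≡⟨ ∑-comm (λ x i → sum (λ j → w i j * at x i j)) ⟩
    sum (λ i → sum (λ x → sum (λ j → w i j * at x i j)))
      ≡⟨ sum-cong-≗ (λ i → sum-swap-factor (w i) (λ j x → at x i j)) ⟩
    sum (λ i → sum (λ j → w i j * sum (λ x → at x i j)))
      ≡⟨ sum-cong-≗ (λ i → sum-cong-≗ λ j → trans (cong (w i j *_) (sum-at i j)) (*-identityʳ _)) ⟩
    sum (λ i → sum (w i)) ∎
    where open ≡-Reasoning

  weighted-≥ : ∀ w x i j → f (i , j) ≡ x → w i j ≤ weighted w x
  weighted-≥ w x i j fij≡x = begin
    w i j                         ≡⟨ *-identityʳ _ ⟨
    w i j * 1                     ≡⟨ cong (w i j *_) (indicator-yes (f (i , j) ≟ x) fij≡x) ⟨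
    w i j * at x i j              ≤⟨ term≤sum (λ j → w i j * at x i j) j ⟩
    sum (λ j → w i j * at x i j)  ≤⟨ term≤sum (λ i → sum (λ j → w i j * at x i j)) i ⟩
    weighted w x                  ∎
    where open ≤-Reasoning

  sum-frequency : sum frequency ≡ n * q
  sum-frequency = begin
    sum frequency                       ≡⟨ sum-cong-≗ (λ x → sum-cong-≗ λ i → sum-cong-≗ λ j → sym (*-identityˡ (at x i j))) ⟩
    sum (weighted (λ _ _ → 1))          ≡⟨ sum-weighted (λ _ _ → 1) ⟩
    sum {n} (λ _ → sum {q} (λ _ → 1))   ≡⟨ sum-cong-≗ {n} (λ _ → trans (sum-const q 1) (*-identityʳ q)) ⟩
    sum {n} (λ _ → q)                   ≡⟨ sum-const n q ⟩
    n * q                               ∎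
    where open ≡-Reasoning

  inRow-≥1 : ∀ {c i j} → f (i , j) ≡ c → 1 ≤ inRow c i
  inRow-≥1 {c} {i} {j} fij≡c = ≤-trans
    (≤-reflexive (sym (indicator-yes (f (i , j) ≟ c) fij≡c))) (term≤sum (at c i) j)

  inColumn-≥1 : ∀ {c i j} → f (i , j) ≡ c → 1 ≤ inColumn c j
  inColumn-≥1 {c} {i} {j} fij≡c = ≤-trans
    (≤-reflexive (sym (indicator-yes (f (i , j) ≟ c) fij≡c))) (term≤sum (λ i → at c i j) i)

  at-≢0 : ∀ {c i j} → at c i j ≢ 0 → f (i , j) ≡ c
  at-≢0 {c} {i} {j} at≢0 with f (i , j) ≟ c
  ... | yes fij≡c = fij≡c
  ... | no  _     = contradiction refl at≢0

  module _ (proper : IsProper (K n □ K q) f) where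

    -- A row is a clique of the product, so a proper colouring cannot repeat a colour in it.
    inRow-≤1 : ∀ c i → inRow c i ≤ 1
    inRow-≤1 c i = sum-≤1 (at c i) (λ j → indicator-≤1 (f (i , j) ≟ c)) unique
      where
      unique : ∀ j j′ → at c i j ≢ 0 → at c i j′ ≢ 0 → j ≡ j′
      unique j j′ h h′ with j ≟ j′
      ... | yes j≡j′ = j≡j′
      ... | no  j≢j′ = contradiction (trans (at-≢0 {c} {i} {j} h) (sym (at-≢0 {c} {i} {j′} h′)))
                         (proper _ _ (inRight j≢j′))

    module _ (complete : IsComplete (K n □ K q) f) (c : Fin k) where

      private
        ρ ρ′ : Fin n → ℕ
        ρ  = inRow c
        ρ′ i = 1 ∸ ρ i
        γ : Fin q → ℕ
        γ = inColumn c

        -- The indicator of the union of the rows and columns containing c.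
        w : Fin n → Fin q → ℕ
        w i j = ρ i + ρ′ i * γ j

        w-row : ∀ {i} j → 1 ≤ ρ i → 1 ≤ w i j
        w-row j ρ≥1 = ≤-trans ρ≥1 (m≤m+n _ _)

        w-column : ∀ i {j} → 1 ≤ γ j → 1 ≤ w i j
        w-column i {j} γ≥1 with ρ i
        ... | zero  = ≤-trans γ≥1 (≤-reflexive (sym (+-identityʳ (γ j))))
        ... | suc _ = s≤s z≤n

        -- Completeness gives a cell of colour `x` adjacent to a cell of colour `c`. Adjacent cells
        -- share a row or a column, so the cell of colour `x` lies in the union.
        others : ∀ x → x ≢ c → 1 ≤ weighted w x
        others x x≢c with complete c x (x≢c ∘ sym)
        ... | (i , _) , (_ , j) , inRight _ , fv₁≡c , fv₂≡x =
          ≤-trans (w-row {i} j (inRow-≥1 fv₁≡c)) (weighted-≥ w x i j fv₂≡x)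
        ... | (_ , j) , (i , _) , inLeft _ , fv₁≡c , fv₂≡x =
          ≤-trans (w-column i (inColumn-≥1 fv₁≡c)) (weighted-≥ w x i j fv₂≡x)

        -- All occurrences of `c` lie in the union, so `c` uses up `frequency c` of its cells rather
        -- than one. The estimate for rare colours depends on this surplus.
        own : frequency c ≤ weighted w c
        own = sum-mono λ i → sum-mono λ j → at≤ i j
          where
          at≤ : ∀ i j → at c i j ≤ w i j * at c i j
          at≤ i j with f (i , j) ≟ c in eq
          ... | no  _     = z≤n
          ... | yes fij≡c = ≤-trans (w-row {i} j (inRow-≥1 fij≡c)) (≤-reflexive (sym (*-identityʳ _)))

        l l′ : ℕ
        l  = frequency c
        l′ = sum ρ′

        -- Each of the `l` rows containing `c` lies wholly in the union. Each of the `l′` other rows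
        -- meets it in the columns of `c`, and counting `c` by columns gives `l` again.
        sum-w : sum (λ i → sum (w i)) ≡ l * q + l′ * l
        sum-w = begin
          sum (λ i → sum (λ j → ρ i + ρ′ i * γ j))
            ≡⟨ sum-cong-≗ (λ i → trans (∑-distrib-+ (λ _ → ρ i) (λ j → ρ′ i * γ j))
                 (cong₂ _+_ (trans (sum-const q (ρ i)) (*-comm q (ρ i))) (sym (*-distribˡ-sum (ρ′ i) γ)))) ⟩
          sum (λ i → ρ i * q + ρ′ i * sum γ)
            ≡⟨ ∑-distrib-+ (λ i → ρ i * q) (λ i → ρ′ i * sum γ) ⟩
          sum (λ i → ρ i * q) + sum (λ i → ρ′ i * sum γ)
            ≡⟨ cong₂ _+_ (*-distribʳ-sum q ρ) (*-distribʳ-sum (sum γ) ρ′) ⟨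
          l * q + l′ * sum γ
            ≡⟨ cong (λ m → l * q + l′ * m) (∑-comm (λ j i → at c i j)) ⟩
          l * q + l′ * l ∎
          where open ≡-Reasoning

      -- The union has `l * q + l′ * l` cells and must hold `c` itself `l` times and each of the
      -- `k - 1` other colours at least once.
      colour-neighbourhood : ∃ λ l′ → frequency c + l′ ≡ n
        × k + frequency c ≤ frequency c * q + l′ * frequency c + 1
      colour-neighbourhood = l′ , l+l′≡n , bound
        where
        l+l′≡n : l + l′ ≡ n
        l+l′≡n = begin
          sum ρ + sum ρ′          ≡⟨ ∑-distrib-+ ρ ρ′ ⟨
          sum (λ i → ρ i + ρ′ i)  ≡⟨ sum-cong-≗ (λ i → m+[n∸m]≡n (inRow-≤1 c i)) ⟩
          sum {n} (λ _ → 1)       ≡⟨ sum-const n 1 ⟩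
          n * 1                   ≡⟨ *-identityʳ n ⟩
          n                       ∎
          where open ≡-Reasoning
        bound : k + l ≤ l * q + l′ * l + 1
        bound = begin
          k + l                         ≡⟨ cong (_+ l) (trans (sum-const k 1) (*-identityʳ k)) ⟨
          sum {k} (λ _ → 1) + l         ≤⟨ +-monoʳ-≤ (sum {k} (λ _ → 1)) own ⟩
          sum {k} (λ _ → 1) + weighted w c
            ≤⟨ sum-mono-off (λ _ → 1) (weighted w) c others ⟩
          sum (weighted w) + 1          ≡⟨ cong (_+ 1) (trans (sum-weighted w) sum-w) ⟩
          l * q + l′ * l + 1            ∎
          where open ≤-Reasoning

-- Estimates for rare and for frequent colours

m≤m*m : ∀ m → m ≤ m * m
m≤m*m zero    = z≤n
m≤m*m (suc m) = m≤m*n (suc m) (suc m)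

-- With `r = l + d` one has `l′ = r² + d + 1`, so after cancelling `l` the bound is
-- `l q + l r² + d l + 1`, where `q = (r + 1) s + t`. Replacing `l q` by `r q` and `d l` by `d r²`
-- gives `r q + r³ + 1`, at most `r q + s`, which is the claimed value.
rare-colour-bound : ∀ {k r s t l l′} → l ≤ r → r ^ 3 + 1 ≤ s → l + l′ ≡ r * r + r + 1 →
  k + l ≤ l * ((r + 1) * s + t) + l′ * l + 1 → k ≤ (r * r + r + 1) * s + r * t
rare-colour-bound {k} {r} {s} {t} {l} {l′} l≤r r³<s l+l′≡n bound with ≤⇒≤″ l≤r
... | record { quotient = d ; equality = refl } = +-cancelʳ-≤ l _ _ (begin
  k + l                                       ≤⟨ bound ⟩
  l * q + l′ * l + 1                          ≡⟨ cong (λ m → l * q + m * l + 1) l′≡ ⟩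
  l * q + (r′ * r′ + d + 1) * l + 1           ≡⟨ regroup l q (r′ * r′) d ⟩
  l * q + (l * (r′ * r′) + d * l) + 1 + l
    ≤⟨ +-monoˡ-≤ l (+-monoˡ-≤ 1 (+-mono-≤ (*-monoˡ-≤ q (m≤m+n l d))
         (+-monoʳ-≤ (l * (r′ * r′)) (*-monoʳ-≤ d l≤r²)))) ⟩
  r′ * q + (l * (r′ * r′) + d * (r′ * r′)) + 1 + l ≡⟨ cube l d s t ⟩
  r′ * (r′ + 1) * s + r′ * t + (r′ ^ 3 + 1) + l    ≤⟨ +-monoˡ-≤ l (+-monoʳ-≤ (r′ * (r′ + 1) * s + r′ * t) r³<s) ⟩
  r′ * (r′ + 1) * s + r′ * t + s + l               ≡⟨ cong (_+ l) (collect r′ s t) ⟩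
  (r′ * r′ + r′ + 1) * s + r′ * t + l              ∎)
  where
  open ≤-Reasoning
  r′ = l + d
  q = (r′ + 1) * s + t
  l≤r² : l ≤ r′ * r′
  l≤r² = ≤-trans (m≤m+n l d) (m≤m*m r′)
  l′≡ : l′ ≡ r′ * r′ + d + 1
  l′≡ = +-cancelˡ-≡ l _ _ (trans l+l′≡n (lem l d (r′ * r′)))
    where
    lem : ∀ l d m → m + (l + d) + 1 ≡ l + (m + d + 1)
    lem = solve-∀
  regroup : ∀ l q m d → l * q + (m + d + 1) * l + 1 ≡ l * q + (l * m + d * l) + 1 + l
  regroup = solve-∀
  cube : ∀ l d s t → (l + d) * (((l + d) + 1) * s + t) + (l * ((l + d) * (l + d)) + d * ((l + d) * (l + d))) + 1 + l
    ≡ (l + d) * ((l + d) + 1) * s + (l + d) * t + ((l + d) * ((l + d) * ((l + d) * 1)) + 1) + l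
  cube = solve-∀
  collect : ∀ r s t → r * (r + 1) * s + r * t + s ≡ (r * r + r + 1) * s + r * t
  collect = solve-∀

-- The number of cells equals `B * (r + 1) + t` with `t < r + 1`, so `B` is the integer quotient by
-- `r + 1`.
frequent-colours-bound : ∀ {k r s t} → t ≤ r →
  k * suc r ≤ (r * r + r + 1) * ((r + 1) * s + t) → k ≤ (r * r + r + 1) * s + r * t
frequent-colours-bound {k} {r} {s} {t} t≤r bound = ≮⇒≥ λ B<k → <⇒≱ (≤-<-trans t≤r (n<1+n r))
  (+-cancelˡ-≤ (((r * r + r + 1) * s + r * t) * suc r) _ _ (begin
    B * suc r + suc r                       ≡⟨ +-comm (B * suc r) (suc r) ⟩
    suc B * suc r                           ≤⟨ *-monoˡ-≤ (suc r) B<k ⟩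
    k * suc r                               ≤⟨ bound ⟩
    (r * r + r + 1) * ((r + 1) * s + t)     ≡⟨ lem r s t ⟩
    B * suc r + t                           ∎))
  where
  open ≤-Reasoning
  B = (r * r + r + 1) * s + r * t
  lem : ∀ r s t → (r * r + r + 1) * ((r + 1) * s + t) ≡ ((r * r + r + 1) * s + r * t) * (1 + r) + t
  lem = solve-∀

upper-bound : ∀ {r s t} → r ^ 3 + 1 ≤ s → t ≤ r →
  AchrAtMost (K (r * r + r + 1) □ K ((r + 1) * s + t)) ((r * r + r + 1) * s + r * t)
upper-bound {r} {s} {t} r³<s t≤r k (f , proper , complete)
  with all? (λ c → suc r ≤? frequency c)
  where open Frequencies f
... | yes frequent = frequent-colours-bound t≤r (begin
  k * suc r               ≡⟨ sum-const k (suc r) ⟨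
  sum {k} (λ _ → suc r)   ≤⟨ sum-mono frequent ⟩
  sum frequency           ≡⟨ sum-frequency ⟩
  (r * r + r + 1) * ((r + 1) * s + t) ∎)
  where
  open ≤-Reasoning
  open Frequencies f
... | no ¬frequent = go
  where
  open Frequencies f
  go : k ≤ (r * r + r + 1) * s + r * t
  -- Decidability turns the failed universal statement into a colour occurring at most `r` times,
  -- which takes the place of a rarest one.
  go with ¬∀⟶∃¬ k _ (λ c → suc r ≤? frequency c) ¬frequent
  ... | c , rare with colour-neighbourhood proper complete c
  ...   | l′ , l+l′≡n , bound = rare-colour-bound (≮⇒≥ rare) r³<s l+l′≡n bound

-- Counting in finite projective planes

-- The axioms in numerical form, symmetric in points and lines, so that `points-count` also counts
-- lines by way of `dual`. Idempotence makes every entry 0 or 1.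
record IncidenceMatrix (P L : ℕ) : Set where
  field
    inc      : Fin P → Fin L → ℕ
    inc-idem : ∀ p l → inc p l * inc p l ≡ inc p l
    join     : ∀ {p q} → p ≢ q → sum (λ l → inc p l * inc q l) ≡ 1
    meet     : ∀ {l m} → l ≢ m → sum (λ p → inc p l * inc p m) ≡ 1

  degree : Fin P → ℕ
  degree p = sum (inc p)

  size : Fin L → ℕ
  size l = sum (λ p → inc p l)

dual : ∀ {P L} → IncidenceMatrix P L → IncidenceMatrix L P
dual M = record
  { inc      = λ l p → inc p l
  ; inc-idem = λ l p → inc-idem p l
  ; join     = meet
  ; meet     = join
  }
  where open IncidenceMatrix M

module _ {P L : ℕ} (M : IncidenceMatrix P L) where
  open IncidenceMatrix M

  -- Both sides count the flags (q , m) with q on l and m the line joining p to q.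
  degree≡size : ∀ {p l} → inc p l ≡ 0 → degree p ≡ size l
  degree≡size {p} {l} p∉l = begin
    sum (inc p)
      ≡⟨ sum-cong-≗ through-p ⟨
    sum (λ m → inc p m * sum (λ q → inc q m * inc q l))
      ≡⟨ sum-swap-factor (inc p) (λ m q → inc q m * inc q l) ⟨
    sum (λ q → sum (λ m → inc p m * (inc q m * inc q l)))
      ≡⟨ sum-cong-≗ (λ q → sum-cong-≗ λ m → sym (*-assoc (inc p m) (inc q m) (inc q l))) ⟩
    sum (λ q → sum (λ m → inc p m * inc q m * inc q l))
      ≡⟨ sum-cong-≗ (λ q → *-distribʳ-sum (inc q l) (λ m → inc p m * inc q m)) ⟨
    sum (λ q → sum (λ m → inc p m * inc q m) * inc q l)
      ≡⟨ sum-cong-≗ on-l ⟩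
    sum (λ q → inc q l) ∎
    where
    open ≡-Reasoning
    -- A line through `p` differs from `l`, so it meets `l` in one point. At `m = l` the factor
    -- `inc p m` vanishes.
    through-p : ∀ m → inc p m * sum (λ q → inc q m * inc q l) ≡ inc p m
    through-p m with m ≟ l
    ... | yes refl rewrite p∉l = refl
    ... | no  m≢l = trans (cong (inc p m *_) (meet m≢l)) (*-identityʳ _)
    -- A point of `l` differs from `p`, so one line joins the two. At `q = p` the factor `inc q l`
    -- vanishes.
    on-l : ∀ q → sum (λ m → inc p m * inc q m) * inc q l ≡ inc q l
    on-l q with p ≟ q
    ... | yes refl rewrite p∉l = *-zeroʳ (sum (λ m → inc p m * inc p m))
    ... | no  p≢q = trans (cong (_* inc q l) (join p≢q)) (*-identityˡ _)

  -- Count the pairs of a line through `p` and a point on it. There are `D * D` of them; each point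
  -- other than `p` occurs once, and `p` occurs `D` times.
  points-count : ∀ {D} → (∀ p → degree p ≡ D) → (∀ l → size l ≡ D) → Fin P →
    D * D + 1 ≡ P + D
  points-count {D} deg siz p = begin
    D * D + 1                                     ≡⟨ cong (λ x → x * D + 1) (deg p) ⟨
    sum (inc p) * D + 1                           ≡⟨ cong (_+ 1) (*-distribʳ-sum D (inc p)) ⟩
    sum (λ l → inc p l * D) + 1                   ≡⟨ cong (_+ 1) (sum-cong-≗ λ l → cong (inc p l *_) (siz l)) ⟨
    sum (λ l → inc p l * size l) + 1              ≡⟨ cong (_+ 1) (sum-swap-factor (inc p) (λ l q → inc q l)) ⟨
    sum (λ q → sum (λ l → inc p l * inc q l)) + 1 ≡⟨ sum-cong-off _ (λ _ → 1) p (λ q q≢p → join (q≢p ∘ sym)) ⟩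
    sum {P} (λ _ → 1) + sum (λ l → inc p l * inc p l)
      ≡⟨ cong₂ _+_ (trans (sum-const P 1) (*-identityʳ P)) (trans (sum-cong-≗ (inc-idem p)) (deg p)) ⟩
    P + D ∎
    where open ≡-Reasoning

-- Sizes and enumerations of subsets

∣∣≡sum : ∀ {n} (S : Subset n) → ∣ S ∣ ≡ sum (λ x → indicator (x ∈? S))
∣∣≡sum []          = refl
∣∣≡sum (true ∷ S)  = cong suc (∣∣≡sum S)
∣∣≡sum (false ∷ S) = ∣∣≡sum S

element : ∀ {n} (S : Subset n) → Fin ∣ S ∣ → Fin n
element (true  ∷ S) zero    = zero
element (true  ∷ S) (suc i) = suc (element S i)
element (false ∷ S) i       = suc (element S i)

element-injective : ∀ {n} (S : Subset n) {i j} → element S i ≡ element S j → i ≡ j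
element-injective (true  ∷ S) {zero}  {zero}  _  = refl
element-injective (true  ∷ S) {suc i} {suc j} eq = cong suc (element-injective S (Fin.suc-injective eq))
element-injective (false ∷ S) eq = element-injective S (Fin.suc-injective eq)

element-surjective : ∀ {n} (S : Subset n) {x} → x ∈ S → ∃ λ i → element S i ≡ x
element-surjective (true ∷ S) here = zero , refl
element-surjective (true ∷ S) (there x∈S) with element-surjective S x∈S
... | i , refl = suc i , refl
element-surjective (false ∷ S) (there x∈S) with element-surjective S x∈S
... | i , refl = i , refl

-- Regularity of a projective plane and the numbers of its points and lines

module Plane {r : ℕ} (1≤r : 1 ≤ r) (Π : ProjectivePlane r) where
  open ProjectivePlane Π

  line-unique : ∀ {p q l m} → p ≢ q → p ∈ line l → q ∈ line l → p ∈ line m → q ∈ line m → l ≡ m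
  line-unique {p} {q} {l} {m} p≢q p∈l q∈l p∈m q∈m with two-points p q p≢q
  ... | _ , _ , unique = trans (unique l p∈l q∈l) (sym (unique m p∈m q∈m))

  on : Fin npts → Fin nlines → ℕ
  on p l = indicator (p ∈? line l)

  both : ∀ {p q l m} → p ∈ line l → q ∈ line m → on p l * on q m ≡ 1
  both {p} {q} {l} {m} p∈l q∈m =
    cong₂ _*_ (indicator-yes (p ∈? line l) p∈l) (indicator-yes (q ∈? line m) q∈m)

  not-both : ∀ {p q l m} → ¬ (p ∈ line l × q ∈ line m) → on p l * on q m ≡ 0
  not-both {p} {q} {l} {m} ¬both with p ∈? line l | q ∈? line m
  ... | yes p∈l | yes q∈m = contradiction (p∈l , q∈m) ¬both
  ... | yes _   | no  _   = refl
  ... | no  _   | _       = refl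

  matrix : IncidenceMatrix npts nlines
  matrix = record
    { inc      = on
    ; inc-idem = λ p l → indicator-idem (p ∈? line l)
    ; join     = join
    ; meet     = meet
    }
    where
    join : ∀ {p q} → p ≢ q → sum (λ l → on p l * on q l) ≡ 1
    join {p} {q} p≢q with two-points p q p≢q
    ... | l , (p∈l , q∈l) , unique = trans
      (sum-single (λ l′ → on p l′ * on q l′) l λ l′ l′≢l → not-both λ (p∈l′ , q∈l′) → l′≢l (unique l′ p∈l′ q∈l′))
      (both p∈l q∈l)
    meet : ∀ {l m} → l ≢ m → sum (λ p → on p l * on p m) ≡ 1
    meet {l} {m} l≢m with two-lines l m l≢m
    ... | p , p∈l , p∈m = trans
      (sum-single (λ p′ → on p′ l * on p′ m) p λ p′ p′≢p → not-both λ (p′∈l , p′∈m) →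
        l≢m (line-unique p′≢p p′∈l p∈l p′∈m p∈m))
      (both p∈l p∈m)

  open IncidenceMatrix matrix using (degree; size)

  missed : ∀ p l → ¬ p ∈ line l → degree p ≡ size l
  missed p l p∉l = degree≡size matrix {p} {l} (indicator-no (p ∈? line l) p∉l)

  size≡∣∣ : ∀ l → size l ≡ ∣ line l ∣
  size≡∣∣ l = sym (∣∣≡sum (line l))

  -- The given line with `r + 1` points has at least two, and they cannot both be `p`.
  other-point : ∀ p → ∃ λ q → p ≢ q
  other-point p with order-line
  ... | l₀ , ∣l₀∣≡r+1 with p ≟ element (line l₀) i | p ≟ element (line l₀) j
    where
    i j : Fin ∣ line l₀ ∣
    i = fromℕ< {0} (subst (0 <_) (sym ∣l₀∣≡r+1) (m≤n+m 1 r))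
    j = fromℕ< {1} (subst (1 <_) (sym ∣l₀∣≡r+1) (+-monoˡ-≤ 1 1≤r))
  ... | no p≢x | _      = _ , p≢x
  ... | yes _  | no p≢y = _ , p≢y
  ... | yes p≡x | yes p≡y = contradiction
    (Fin.fromℕ<-injective 0 1 _ _ (element-injective (line l₀) (trans (sym p≡x) p≡y))) λ ()

  -- The case `p = q` serves pairs of colours on the same point, and lets corners of a quadrangle be
  -- joined without first proving them distinct.
  common-line : ∀ p q → ∃ λ l → p ∈ line l × q ∈ line l
  common-line p q with p ≟ q
  ... | no p≢q with two-points p q p≢q
  ...   | l , on-l , _ = l , on-l
  common-line p q | yes refl with other-point p
  ... | p′ , p≢p′ with two-points p p′ p≢p′
  ...   | l , (p∈l , _) , _ = l , p∈l , p∈l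

  Triangle : Fin npts → Fin npts → Fin npts → Set
  Triangle a b c = ∀ l → ¬ (a ∈ line l × b ∈ line l × c ∈ line l)

  -- The sides of a triangle have no common point: if it were `a`, then `a` would lie on `bc`;
  -- otherwise `ab` and `ac` would share two points and coincide.
  avoiding-line : ∀ {a b c} → Triangle a b c → ∀ p → ∃ λ l → ¬ p ∈ line l
  avoiding-line {a} {b} {c} △ p
    with common-line a b | common-line a c | common-line b c
  ... | ab , a∈ab , b∈ab | ac , a∈ac , c∈ac | bc , b∈bc , c∈bc
    with p ∈? line ab | p ∈? line ac | p ∈? line bc | p ≟ a
  ... | no p∉ab  | _        | _        | _       = ab , p∉ab
  ... | _        | no p∉ac  | _        | _       = ac , p∉ac
  ... | _        | _        | no p∉bc  | _       = bc , p∉bc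
  ... | yes _    | yes _    | yes a∈bc | yes refl = contradiction (a∈bc , b∈bc , c∈bc) (△ bc)
  ... | yes p∈ab | yes p∈ac | yes _    | no p≢a  with line-unique p≢a p∈ab a∈ab p∈ac a∈ac
  ...   | refl = contradiction (a∈ab , b∈ab , c∈ac) (△ ab)

  -- The line joining the other two corners of a quadrangle misses both points.
  corner-degrees : ∀ {a b c d} → Triangle a c d → Triangle b c d → degree a ≡ degree b
  corner-degrees {a} {b} {c} {d} acd bcd with common-line c d
  ... | l , c∈l , d∈l = trans
    (missed a l λ a∈l → acd l (a∈l , c∈l , d∈l))
    (sym (missed b l λ b∈l → bcd l (b∈l , c∈l , d∈l)))

  -- The corners `a`, `b`, `c` have equal degrees and every line misses one of them, so all lines
  -- have that common degree as size. The line of `order-line` fixes its value.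
  size≡ : ∀ l → size l ≡ r + 1
  size≡ with four-points
  ... | a , b , c , d , abc , abd , acd , bcd = λ l → trans (size≡deg-a l) (sym (order-deg-a))
    where
    b≡a : degree b ≡ degree a
    b≡a = corner-degrees bcd acd
    c≡a : degree c ≡ degree a
    c≡a = corner-degrees (λ l (c∈ , b∈ , d∈) → bcd l (b∈ , c∈ , d∈)) (λ l (a∈ , b∈ , d∈) → abd l (a∈ , b∈ , d∈))
    size≡deg-a : ∀ l → size l ≡ degree a
    size≡deg-a l with a ∈? line l | b ∈? line l | c ∈? line l
    ... | no a∉l | _ | _ = sym (missed a l a∉l)
    ... | _ | no b∉l | _ = trans (sym (missed b l b∉l)) b≡a
    ... | _ | _ | no c∉l = trans (sym (missed c l c∉l)) c≡a
    ... | yes a∈l | yes b∈l | yes c∈l = contradiction (a∈l , b∈l , c∈l) (abc l)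
    order-deg-a : r + 1 ≡ degree a
    order-deg-a = trans (sym (proj₂ order-line))
      (trans (sym (size≡∣∣ (proj₁ order-line))) (size≡deg-a (proj₁ order-line)))

  degree≡ : ∀ p → degree p ≡ r + 1
  degree≡ p with four-points
  ... | _ , _ , _ , _ , abc , _ with avoiding-line abc p
  ...   | l , p∉l = trans (missed p l p∉l) (size≡ l)

  private
    square : ∀ {n} → (r + 1) * (r + 1) + 1 ≡ n + (r + 1) → n ≡ r * r + r + 1
    square {n} eq = +-cancelʳ-≡ (r + 1) n _ (trans (sym eq) (expand r))
      where
      expand : ∀ r → (r + 1) * (r + 1) + 1 ≡ r * r + r + 1 + (r + 1)
      expand = solve-∀

  npts≡ : npts ≡ r * r + r + 1
  npts≡ = square (points-count matrix degree≡ size≡ (proj₁ four-points))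

  nlines≡ : nlines ≡ r * r + r + 1
  nlines≡ = square (points-count (dual matrix) size≡ degree≡ (proj₁ order-line))

-- The construction for the lower bound

-- Columns and colours are renamed to structured types `C` and `X`. Completeness is obtained from
-- rows alone: any two colours occur together in some row.
completeColouring : ∀ {n q k} {C X : Set} → Fin q ↔ C → Fin k ↔ X → (f : Fin n → C → X) →
  (∀ i {c c′} → f i c ≡ f i c′ → c ≡ c′) →
  (∀ {i i′} c → f i c ≡ f i′ c → i ≡ i′) →
  (∀ x y → ∃ λ i → (∃ λ c → f i c ≡ x) × (∃ λ c → f i c ≡ y)) →
  HasCompleteColouring (K n □ K q) k
completeColouring {n} {q} {k} columns colours f row-injective column-injective meet =
  colour , proper , complete
  where
  module Col = Inverse columns
  module X = Inverse colours

  to-injective : ∀ {j j′} → Col.to j ≡ Col.to j′ → j ≡ j′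
  to-injective eq = trans (sym (Col.strictlyInverseʳ _)) (trans (cong Col.from eq) (Col.strictlyInverseʳ _))

  from-injective : ∀ {x y} → X.from x ≡ X.from y → x ≡ y
  from-injective eq = trans (sym (X.strictlyInverseˡ _)) (trans (cong X.to eq) (X.strictlyInverseˡ _))

  colour : Fin n × Fin q → Fin k
  colour (i , j) = X.from (f i (Col.to j))

  proper : IsProper (K n □ K q) colour
  proper _ _ (inRight {x = i} j≢j′) eq = j≢j′ (to-injective (row-injective i (from-injective eq)))
  proper _ _ (inLeft i≢i′) eq = i≢i′ (column-injective _ (from-injective eq))

  colour-from : ∀ i {c x} → f i c ≡ X.to x → colour (i , Col.from c) ≡ x
  colour-from i {c} fic≡x = trans (cong (X.from ∘ f i) (Col.strictlyInverseˡ c))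
    (trans (cong X.from fic≡x) (X.strictlyInverseʳ _))

  complete : IsComplete (K n □ K q) colour
  complete x y x≢y with meet (X.to x) (X.to y)
  ... | i , (c , fic≡x) , (d , fid≡y) =
    (i , Col.from c) , (i , Col.from d) , inRight c≢d , colour-from i fic≡x , colour-from i fid≡y
    where
    c≢d : Col.from c ≢ Col.from d
    c≢d eq = x≢y (trans (sym (colour-from i fic≡x)) (trans (cong (λ j → colour (i , j)) eq) (colour-from i fid≡y)))

-- Inserting additional symbols into the rows of an array

module Exchange {A : Set} (_≟ᴬ_ : DecidableEquality A) {t : ℕ} where

  -- For injective `h` this is the permutation of the positions in one row that swaps cell `h j`
  -- with the additional column `j` for every `j`.
  exchange : (Fin t → A) → A ⊎ Fin t → A ⊎ Fin t
  exchange h (inj₂ j) = inj₁ (h j)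
  exchange h (inj₁ a) with any? (λ j → h j ≟ᴬ a)
  ... | yes (j , _) = inj₂ j
  ... | no  _       = inj₁ a

  exchange-involutive : ∀ {h} → (∀ {j j′} → h j ≡ h j′ → j ≡ j′) →
    ∀ c → exchange h (exchange h c) ≡ c
  exchange-involutive {h} h-injective (inj₂ j) with any? (λ j′ → h j′ ≟ᴬ h j)
  -- The search returns some index whose cell is `h j`; injectivity identifies it with `j`.
  ... | yes (_ , eq) = cong inj₂ (h-injective eq)
  ... | no  ∄        = contradiction (j , refl) ∄
  exchange-involutive {h} h-injective (inj₁ a) with any? (λ j → h j ≟ᴬ a) in eq
  ... | yes (_ , hj≡a) = cong inj₁ hj≡a
  ... | no  _ rewrite eq = refl

  -- If row i lists its colours as b i and each additional symbol j takes the cell h i j,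
  -- sending the colour found there to the additional column j, the array remains proper.
  module _ {n : ℕ} {B : Set} (b : Fin n → A → B) (h : Fin n → Fin t → A)
    (b-injective : ∀ i {a a′} → b i a ≡ b i a′ → a ≡ a′)
    (h-injective : ∀ i {j j′} → h i j ≡ h i j′ → j ≡ j′)
    (b-column : ∀ {i i′} a → b i a ≡ b i′ a → i ≡ i′)
    (h-column : ∀ {i i′} j → h i j ≡ h i′ j → i ≡ i′)
    (bh-column : ∀ {i i′} j → b i (h i j) ≡ b i′ (h i′ j) → i ≡ i′)
    where

    array : Fin n → A ⊎ Fin t → B ⊎ Fin t
    array i c = Sum.map₁ (b i) (exchange (h i) c)

    map₁-injective : ∀ i {c c′ : A ⊎ Fin t} → Sum.map₁ (b i) c ≡ Sum.map₁ (b i) c′ → c ≡ c′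
    map₁-injective i {inj₁ _} {inj₁ _} eq = cong inj₁ (b-injective i (inj₁-injective eq))
    map₁-injective i {inj₂ _} {inj₂ _} refl = refl

    array-row : ∀ i {c c′} → array i c ≡ array i c′ → c ≡ c′
    array-row i {c} {c′} eq = begin
      c                                  ≡⟨ exchange-involutive (h-injective i) c ⟨
      exchange (h i) (exchange (h i) c)  ≡⟨ cong (exchange (h i)) (map₁-injective i {exchange (h i) c} {exchange (h i) c′} eq) ⟩
      exchange (h i) (exchange (h i) c′) ≡⟨ exchange-involutive (h-injective i) c′ ⟩
      c′                                 ∎
      where open ≡-Reasoning

    -- An additional column holds displaced colours, separated by `bh-column`. In an ordinary column
    -- a repeated additional symbol would have the same cell in both rows, against `h-column`;
    -- repeated undisplaced colours fall to `b-column`.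
    array-column : ∀ {i i′} c → array i c ≡ array i′ c → i ≡ i′
    array-column (inj₂ j) eq = bh-column j (inj₁-injective eq)
    array-column {i} {i′} (inj₁ a) eq
      with any? (λ j → h i j ≟ᴬ a) | any? (λ j → h i′ j ≟ᴬ a)
    array-column (inj₁ a) refl | yes (j , eq) | yes (_ , eq′) = h-column j (trans eq (sym eq′))
    array-column (inj₁ a) ()   | yes _        | no  _
    array-column (inj₁ a) ()   | no  _        | yes _
    array-column (inj₁ a) eq   | no  _        | no  _ = b-column a (inj₁-injective eq)

    array-exchange : ∀ i c → array i (exchange (h i) c) ≡ Sum.map₁ (b i) c
    array-exchange i c = cong (Sum.map₁ (b i)) (exchange-involutive (h-injective i) c)

    -- A row keeps all its colours, since they are only permuted, and contains every additional
    -- symbol. The default `x₀` stands in for a symbol when a row is chosen.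
    array-meet : B → (∀ x y → ∃ λ i → (∃ λ a → b i a ≡ x) × (∃ λ a → b i a ≡ y)) →
      ∀ x y → ∃ λ i → (∃ λ c → array i c ≡ x) × (∃ λ c → array i c ≡ y)
    array-meet x₀ b-meet x y with b-meet (underlying x) (underlying y)
      where
      underlying : B ⊎ Fin t → B
      underlying = Sum.[ id , (λ _ → x₀) ]
    ... | i , ax , ay = i , occurs x ax , occurs y ay
      where
      occurs : ∀ z → (∃ λ a → b i a ≡ Sum.[ id , (λ _ → x₀) ] z) → ∃ λ c → array i c ≡ z
      occurs (inj₁ _) (a , eq) = exchange (h i) (inj₁ a) , trans (array-exchange i (inj₁ a)) (cong inj₁ eq)
      occurs (inj₂ j) _        = exchange (h i) (inj₂ j) , array-exchange i (inj₂ j)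

-- Addition modulo `s`

data ModSum {s} (x y z : Fin s) : Set where
  -- Separate constructors record whether the sum wraps around, which `offset` reads off later.
  plain   : toℕ x + toℕ y ≡ toℕ z     → ModSum x y z
  wrapped : toℕ x + toℕ y ≡ toℕ z + s → ModSum x y z

module _ {s : ℕ} where

  modSum : ∀ (x y : Fin s) → ∃ (ModSum x y)
  modSum x y with toℕ x + toℕ y <? s
  ... | yes x+y<s = fromℕ< x+y<s , plain (sym (Fin.toℕ-fromℕ< x+y<s))
  ... | no  x+y≮s = fromℕ< lt , wrapped (trans (sym (m∸n+n≡m s≤x+y)) (cong (_+ s) (sym (Fin.toℕ-fromℕ< lt))))
    where
    s≤x+y = ≮⇒≥ x+y≮s
    lt : toℕ x + toℕ y ∸ s < s
    lt = +-cancelʳ-< s _ _ (subst (_< s + s) (sym (m∸n+n≡m s≤x+y)) (+-mono-< (Fin.toℕ<n x) (Fin.toℕ<n y)))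

  modDifference : ∀ (z y : Fin s) → ∃ λ x → ModSum x y z
  modDifference z y with toℕ y ≤? toℕ z
  ... | yes y≤z = fromℕ< lt , plain (trans (cong (_+ toℕ y) (Fin.toℕ-fromℕ< lt)) (m∸n+n≡m y≤z))
    where
    lt : toℕ z ∸ toℕ y < s
    lt = ≤-<-trans (m∸n≤m (toℕ z) (toℕ y)) (Fin.toℕ<n z)
  ... | no y≰z = fromℕ< lt , wrapped (trans (cong (_+ toℕ y) (Fin.toℕ-fromℕ< lt)) (m∸n+n≡m y≤z+s))
    where
    y≤z+s : toℕ y ≤ toℕ z + s
    y≤z+s = ≤-trans (<⇒≤ (Fin.toℕ<n y)) (m≤n+m s (toℕ z))
    lt : toℕ z + s ∸ toℕ y < s
    lt = +-cancelʳ-< (toℕ y) _ _ (subst₂ _<_ (sym (m∸n+n≡m y≤z+s)) (+-comm (toℕ y) s) (+-monoˡ-< s (≰⇒> y≰z)))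

  private
    overflow : ∀ (x y : Fin s) → toℕ x ≢ toℕ y + s
    overflow x y eq = <⇒≱ (Fin.toℕ<n x) (subst (s ≤_) (sym eq) (m≤n+m s (toℕ y)))

  modSum-unique : ∀ {x y z z′ : Fin s} → ModSum x y z → ModSum x y z′ → z ≡ z′
  modSum-unique (plain p) (plain q) = Fin.toℕ-injective (trans (sym p) q)
  modSum-unique {z = z} {z′} (plain p) (wrapped q) = contradiction (trans (sym p) q) (overflow z z′)
  modSum-unique {z = z} {z′} (wrapped p) (plain q) = contradiction (trans (sym q) p) (overflow z′ z)
  modSum-unique (wrapped p) (wrapped q) = Fin.toℕ-injective (+-cancelʳ-≡ s _ _ (trans (sym p) q))

  modSum-cancelʳ : ∀ {x x′ y z : Fin s} → ModSum x y z → ModSum x′ y z → x ≡ x′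
  modSum-cancelʳ {y = y} (plain p) (plain q) = Fin.toℕ-injective (+-cancelʳ-≡ (toℕ y) _ _ (trans p (sym q)))
  modSum-cancelʳ {x} {x′} {y} (plain p) (wrapped q) = contradiction (shift x x′ y p q) (overflow x′ x)
    where
    shift : ∀ {z} (x x′ y : Fin s) → toℕ x + toℕ y ≡ z → toℕ x′ + toℕ y ≡ z + s → toℕ x′ ≡ toℕ x + s
    shift x x′ y p q = +-cancelʳ-≡ (toℕ y) _ _
      (trans q (trans (cong (_+ s) (sym p)) (assoc-swap (toℕ x) (toℕ y) s)))
      where
      assoc-swap : ∀ a b c → a + b + c ≡ a + c + b
      assoc-swap = solve-∀
  modSum-cancelʳ p@(wrapped _) q@(plain _) = sym (modSum-cancelʳ q p)
  modSum-cancelʳ {y = y} (wrapped p) (wrapped q) = Fin.toℕ-injective (+-cancelʳ-≡ (toℕ y) _ _ (trans p (sym q)))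

  modSum-comm : ∀ {x y z : Fin s} → ModSum x y z → ModSum y x z
  modSum-comm {x} {y} (plain p)   = plain (trans (+-comm (toℕ y) (toℕ x)) p)
  modSum-comm {x} {y} (wrapped p) = wrapped (trans (+-comm (toℕ y) (toℕ x)) p)

  modSum-cancelˡ : ∀ {x y y′ z : Fin s} → ModSum x y z → ModSum x y′ z → y ≡ y′
  modSum-cancelˡ p q = modSum-cancelʳ (modSum-comm p) (modSum-comm q)

-- The array of a projective plane

module Construction {r : ℕ} (1≤r : 1 ≤ r) (Π : ProjectivePlane r) {s t : ℕ}
  (nlines≤s : ProjectivePlane.nlines Π ≤ s) (t≤r : t ≤ r) where
  open ProjectivePlane Π
  open Plane 1≤r Π

  Cell : Set
  Cell = Fin (suc r) × Fin s

  -- Lines are read as residues modulo `s`; since there are at most `s` lines, distinct lines give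
  -- distinct shifts.
  ι : Fin nlines → Fin s
  ι l = inject≤ l nlines≤s

  ∣line∣≡ : ∀ l → suc r ≡ ∣ line l ∣
  ∣line∣≡ l = trans (+-comm 1 r) (trans (sym (size≡ l)) (size≡∣∣ l))

  point : Fin nlines → Fin (suc r) → Fin npts
  point l a = element (line l) (cast (∣line∣≡ l) a)

  point-surjective : ∀ {p l} → p ∈ line l → ∃ λ a → point l a ≡ p
  point-surjective {p} {l} p∈l with element-surjective (line l) p∈l
  ... | a , refl = cast (sym (∣line∣≡ l)) a ,
    cong (element (line l)) (Fin.cast-involutive (∣line∣≡ l) (sym (∣line∣≡ l)) a)

  base : Fin nlines → Cell → Fin npts × Fin s
  base l (a , k) = point l a , proj₁ (modDifference k (ι l))

  base-injective : ∀ l {c c′} → base l c ≡ base l c′ → c ≡ c′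
  base-injective l {a , k} {a′ , k′} eq = cong₂ _,_ a≡a′ k≡k′
    where
    a≡a′ : a ≡ a′
    a≡a′ = Fin.toℕ-injective (trans (sym (Fin.toℕ-cast _ a))
      (trans (cong toℕ (element-injective (line l) (cong proj₁ eq))) (Fin.toℕ-cast _ a′)))
    k≡k′ : k ≡ k′
    k≡k′ = modSum-unique (proj₂ (modDifference k (ι l)))
      (subst (λ x → ModSum x (ι l) k′) (sym (cong proj₂ eq)) (proj₂ (modDifference k′ (ι l))))

  -- In a fixed column the second coordinate `k - l` already determines `l`.
  base-column : ∀ {l l′} c → base l c ≡ base l′ c → l ≡ l′
  base-column {l} {l′} (a , k) eq = Fin.inject≤-injective _ _ _ _
    (modSum-cancelˡ (proj₂ (modDifference k (ι l)))
      (subst (λ x → ModSum x (ι l′) k) (sym (cong proj₂ eq)) (proj₂ (modDifference k (ι l′)))))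

  base-meet : ∀ x y → ∃ λ l → (∃ λ c → base l c ≡ x) × (∃ λ c → base l c ≡ y)
  base-meet (p , k) (q , m) with common-line p q
  ... | l , p∈l , q∈l = l , occurs p∈l k , occurs q∈l m
    where
    occurs : ∀ {x} → x ∈ line l → ∀ k → ∃ λ c → base l c ≡ (x , k)
    occurs x∈l k with point-surjective x∈l | modSum k (ι l)
    ... | a , refl | k′ , σ = (a , k′) ,
      cong (point l a ,_) (modSum-cancelʳ (proj₂ (modDifference k′ (ι l))) σ)

  -- Doubling mod s is at most two-to-one, and the first coordinate, shifted by one when
  -- the double wraps around, separates the two preimages.
  offset : ∀ {x y z : Fin s} → ModSum x y z → Fin t → Fin (suc r)
  offset (plain _)   j = inject₁ (inject≤ j t≤r)
  -- As `j < t ≤ r`, the shifted value `j + 1` is still one of the `r + 1` first coordinates.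
  offset (wrapped _) j = suc (inject≤ j t≤r)

  offset-injective : ∀ {x y z : Fin s} (σ : ModSum x y z) {j j′} → offset σ j ≡ offset σ j′ → j ≡ j′
  offset-injective (plain _)   eq = Fin.inject≤-injective _ _ _ _ (Fin.inject₁-injective eq)
  offset-injective (wrapped _) eq = Fin.inject≤-injective _ _ _ _ (Fin.suc-injective eq)

  inject₁≢suc : ∀ {n} (i : Fin n) → inject₁ i ≢ suc i
  inject₁≢suc i eq = 1+n≢n (trans (sym (cong toℕ eq)) (Fin.toℕ-inject₁ i))

  double-injective : ∀ {m n} → m + m ≡ n + n → m ≡ n
  double-injective {m} {n} eq = *-cancelˡ-≡ m n 2
    (trans (cong (m +_) (+-identityʳ m)) (trans eq (cong (n +_) (sym (+-identityʳ n)))))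

  -- Equal offsets mean that both doubles wrap around or neither does, so `x + x` and `y + y` agree
  -- as integers.
  offset-separates : ∀ {x y z : Fin s} (σ : ModSum x x z) (τ : ModSum y y z) j →
    offset σ j ≡ offset τ j → x ≡ y
  offset-separates (plain p)   (plain q)   j _  = Fin.toℕ-injective (double-injective (trans p (sym q)))
  offset-separates (plain _)   (wrapped _) j eq = contradiction eq (inject₁≢suc (inject≤ j t≤r))
  offset-separates (wrapped _) (plain _)   j eq = contradiction (sym eq) (inject₁≢suc (inject≤ j t≤r))
  offset-separates (wrapped p) (wrapped q) j _  = Fin.toℕ-injective (double-injective (trans p (sym q)))

  extra : Fin nlines → Fin t → Cell
  extra l j = offset (proj₂ (modSum (ι l) (ι l))) j , proj₁ (modSum (ι l) (ι l))

  extra-injective : ∀ l {j j′} → extra l j ≡ extra l j′ → j ≡ j′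
  extra-injective l eq = offset-injective (proj₂ (modSum (ι l) (ι l))) (cong proj₁ eq)

  extra-column : ∀ {l l′} j → extra l j ≡ extra l′ j → l ≡ l′
  extra-column {l} {l′} j eq with modSum (ι l) (ι l) | modSum (ι l′) (ι l′)
  ... | z , σ | z′ , τ with cong proj₂ eq
  ...   | refl = Fin.inject≤-injective _ _ _ _ (offset-separates σ τ j (cong proj₁ eq))

  -- The displaced colour sits in a column with second coordinate `2l`, so its own is `2l - l = l`.
  base-extra : ∀ l j → proj₂ (base l (extra l j)) ≡ ι l
  base-extra l j = modSum-cancelʳ (proj₂ (modDifference _ (ι l))) (proj₂ (modSum (ι l) (ι l)))

  base-extra-column : ∀ {l l′} j → base l (extra l j) ≡ base l′ (extra l′ j) → l ≡ l′
  base-extra-column {l} {l′} j eq = Fin.inject≤-injective _ _ _ _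
    (trans (sym (base-extra l j)) (trans (cong proj₂ eq) (base-extra l′ j)))

  open Exchange {Cell} (≡-dec _≟_ _≟_) {t}

  -- Used twice, for the columns with `m = r + 1` and for the colours with `m = npts`.
  blocks : ∀ {m} → Fin (m * s + t) ↔ ((Fin m × Fin s) ⊎ Fin t)
  blocks {m} = ↔-trans Fin.+↔⊎ (Fin.*↔× {m} {s} ⊎-↔ ↔-refl)

  colouring : Fin s → HasCompleteColouring (K nlines □ K (suc r * s + t)) (npts * s + t)
  colouring k₀ = completeColouring blocks blocks
    (array base extra base-injective extra-injective base-column extra-column base-extra-column)
    (array-row base extra base-injective extra-injective base-column extra-column base-extra-column)
    (array-column base extra base-injective extra-injective base-column extra-column base-extra-column)
    (array-meet base extra base-injective extra-injective base-column extra-column base-extra-column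
      (proj₁ four-points , k₀) base-meet)

-- Assembly of the bounds

lower-bound : ∀ {r s t} → 2 ≤ r → ProjectivePlane r → r ^ 3 + 1 ≤ s → t ≤ r →
  AchrAtLeast (K (r * r + r + 1) □ K ((r + 1) * s + t)) ((r * r + r + 1) * s + t)
lower-bound {r} {s} {t} 2≤r Π r³<s t≤r =
  (r * r + r + 1) * s + t , ≤-refl ,
  subst₂ (λ n q → HasCompleteColouring (K n □ K q) ((r * r + r + 1) * s + t)) nlines≡ (cong (λ d → d * s + t) (+-comm 1 r))
    (subst (λ n → HasCompleteColouring (K nlines □ K (suc r * s + t)) (n * s + t)) npts≡
      (Construction.colouring (<⇒≤ 2≤r) Π nlines≤s t≤r (fromℕ< 0<s)))
  where
  open ProjectivePlane Π using (nlines)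
  open Plane (<⇒≤ 2≤r) Π using (npts≡; nlines≡)
  0<s : 0 < s
  0<s = ≤-trans (m≤n+m 1 (r ^ 3)) r³<s
  -- Together with `r³ + 1 ≤ s` this fits the `r² + r + 1` lines into the residues modulo `s`.
  r²+r≤r³ : r * r + r ≤ r ^ 3
  r²+r≤r³ = begin
    r * r + r       ≤⟨ +-monoʳ-≤ (r * r) (m≤m*m r) ⟩
    r * r + r * r   ≡⟨ double (r * r) ⟩
    2 * (r * r)     ≤⟨ *-monoˡ-≤ (r * r) 2≤r ⟩
    r * (r * r)     ≡⟨ cube r ⟩
    r ^ 3           ∎
    where
    open ≤-Reasoning
    double : ∀ m → m + m ≡ 2 * m
    double = solve-∀
    cube : ∀ r → r * (r * r) ≡ r * (r * (r * 1))
    cube = solve-∀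
  nlines≤s : nlines ≤ s
  nlines≤s = subst (_≤ s) (sym nlines≡) (≤-trans (+-monoˡ-≤ 1 r²+r≤r³) r³<s)

theorem3p1 : ∀ (r : ℕ) → 2 ≤ r → IsProjectivePlaneOrder r →
    ∀ (s t : ℕ) → r ^ 3 + 1 ≤ s → t ≤ r →
    AchrAtLeast (K (r * r + r + 1) □ K ((r + 1) * s + t)) ((r * r + r + 1) * s + t)
    × AchrAtMost (K (r * r + r + 1) □ K ((r + 1) * s + t)) ((r * r + r + 1) * s + r * t)
theorem3p1 r 2≤r Π s t r³<s t≤r = lower-bound 2≤r Π r³<s t≤r , upper-bound r³<s t≤r
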